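{- Let $G$ be a directed graph in which every vertex has finitely many out-neighbours, let $\Gamma=\mathcal{C}(G)$ be its clausal theory, and let $A\subseteq \ddot G$ be a clause. Then $\Gamma\models A$ if and only if at least one of the following holds: (1) $A\subseteq \ddot{G^\bot}$ and $G^\bot\neq\emptyset$; (2) there is a nonempty clause $B\subseteq A\cap \ddot{G^{ok}}$ such that $\Gamma\vdash B$.
   Context: A graph is a directed graph $G=\langle G,A_G\rangle$, $A_G\subseteq G\times G$ (loops allowed). Put $A_G(x)=\{y\mid (x,y)\in A_G\}$, $A^-_G(x)=\{y\mid x\in A_G(y)\}$; for $X\subseteq G$, $A_G(X)=\bigcup_{x\in X}A_G(x)$, $A^-_G(X)=\bigcup_{x\in X}A^-_G(x)$, $A_G[X]=X\cup A_G(X)$, $A^-_G[X]=X\cup A^-_G(X)$. Vertices are propositional atoms. For $X\subseteq G$, $\ddot X=X\cup\{\overline x\mid x\in X\}$ is the set of literals over $X$ ($\overline x$ is the negation of $x$). A clause is a finite set of literals; $\{\}$ is the empty clause. The clausal theory $\mathcal{C}(G)$ contains, for each $x\in G$, the clause $\{x\}\cup A_G(x)$ and, for each $y\in A_G(x)$, the clause $\{\overline x,\overline y\}$. $\Gamma\vdash C$ means that $C$ is derivable from the clauses of $\Gamma$ in the system RES, consisting of the axioms $\{a,\overline a\}$ for every atom $a\in G$ and the resolution rule: from $A\cup\{a\}$ and $B\cup\{\overline a\}$ infer $A\cup B$. $G^\bot=\{x\in G\mid \Gamma\vdash \{x\}\text{ and }\Gamma\vdash\{\overline x\}\}$ and $G^{ok}=G\setminus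 G^\bot$. A semikernel of $G$ is a set $S\subseteq G$ with $A_G(S)\subseteq A^-_G(S)\subseteq G\setminus S$; $SK(G)$ is the set of semikernels. $\mathrm{Mod}(G)$ is the set of all $S\in SK(G)$ such that $A^-_G(A^-_G[S])\subseteq A^-_G[S]$ and there is no $R\in SK(G)$ with $A^-_G(A^-_G[R])\subseteq A^-_G[R]$ and $A^-_G[S]\subsetneq A^-_G[R]$. A 3-partition of $G$ is a triple $\alpha=\langle\alpha^{\mathbf 1},\alpha^{\mathbf 0},\alpha^\bot\rangle$ of pairwise disjoint (possibly empty) sets with union $G$. For a clause $C$ with set of positively occurring atoms $P$ and set of negatively occurring atoms $N$, $\alpha\models C$ iff $P\cap\alpha^{\mathbf 1}\neq\emptyset$, or $N\cap\alpha^{\mathbf 0}\neq\emptyset$, or ($P\cup N\subseteq\alpha^\bot$ and $\alpha^\bot\neq\emptyset$). For $S\in\mathrm{Mod}(G)$ let $\alpha_S=\langle S,\,A^-_G(S),\,G\setminus A^-_G[S]\rangle$. $\Gamma\models C$ means that $\alpha_S\models C$ for every $S\in\mathrm{Mod}(G)$. -}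

module Defs where

open import Level using (Level; suc; _⊔_)
open import Axiom.ExcludedMiddle using (ExcludedMiddle)
open import Data.List.Base using (List; []; _∷_; _++_; [_])
import Data.List.Membership.Propositional as List
open import Data.Product using (∃; ∃-syntax; _×_; _,_)
open import Data.Sum using (_⊎_; inj₁; inj₂)
open import Function.Base using (case_of_)
open import Relation.Binary.Bundles using (Poset)
open import Relation.Binary.Core using (Rel)
open import Relation.Binary.PropositionalEquality using (_≡_)
open import Relation.Nullary using (¬_; yes; no)
open import Relation.Unary
  using (Pred; _∈_; _⊆_; _⊂_; _≐_; _∪_; _∩_; ∁; ｛_｝; Satisfiable; _≬_)
  renaming (_⊥_ to _Disjoint_)

-- The axiom of choice in the form of Zorn's lemma.  Chains may be empty, so
-- the hypothesis on upper bounds includes that P is inhabited.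

ZornsLemma : ∀ c ℓ₁ ℓ₂ → Set (suc (c ⊔ ℓ₁ ⊔ ℓ₂))
ZornsLemma c ℓ₁ ℓ₂ =
  (P : Poset c ℓ₁ ℓ₂) → let open Poset P in
  ((K : Pred Carrier (c ⊔ ℓ₁ ⊔ ℓ₂)) →
    (∀ {x y} → x ∈ K → y ∈ K → x ≤ y ⊎ y ≤ x) →
    ∃[ u ] (∀ {x} → x ∈ K → x ≤ u)) →
  ∃[ m ] (∀ x → m ≤ x → x ≈ m)

record Graph (ℓ : Level) : Set (suc ℓ) where
  field
    Vertex : Set ℓ
    Arc    : Rel Vertex ℓ

data Literal {ℓ} (V : Set ℓ) : Set ℓ where
  pos neg : V → Literal V

-- A list stands for the finite set of its members.  Lists with the same
-- members are identified by the `set` rule of RES below, and every other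
-- notion only looks at membership.

Clause : ∀ {ℓ} → Set ℓ → Set ℓ
Clause V = List (Literal V)

module _ {ℓ} {V : Set ℓ} where

  ⟦_⟧ : Clause V → Pred (Literal V) ℓ
  ⟦ C ⟧ l = l List.∈ C

  positive negative : Clause V → Pred V ℓ
  positive C x = pos x ∈ ⟦ C ⟧
  negative C x = neg x ∈ ⟦ C ⟧

  _̈ : Pred V ℓ → Pred (Literal V) ℓ
  (X ̈) (pos x) = x ∈ X
  (X ̈) (neg x) = x ∈ X

  infix 3 _⊢_
  data _⊢_ (Γ : Pred (Clause V) ℓ) : Pred (Clause V) ℓ where
    hyp : ∀ {C} → C ∈ Γ → Γ ⊢ C
    ax  : ∀ a → Γ ⊢ pos a ∷ neg a ∷ []
    res : ∀ {A B} a → Γ ⊢ pos a ∷ A → Γ ⊢ neg a ∷ B → Γ ⊢ A ++ B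
    set : ∀ {C D} → ⟦ C ⟧ ≐ ⟦ D ⟧ → Γ ⊢ C → Γ ⊢ D

record Triple {ℓ} (V : Set ℓ) : Set (suc ℓ) where
  constructor ⟨_,_,_⟩
  field
    𝟏 𝟎 bot : Pred V ℓ

record Is3Partition {ℓ} {V : Set ℓ} (α : Triple V) : Set ℓ where
  open Triple α
  field
    𝟏-𝟎   : 𝟏 Disjoint 𝟎
    𝟏-bot : 𝟏 Disjoint bot
    𝟎-bot : 𝟎 Disjoint bot
    cover : ∀ x → x ∈ 𝟏 ∪ 𝟎 ∪ bot

-- Satisfaction makes sense for arbitrary triples; it is only used for the
-- triples α G S below, which are 3-partitions by α-is3Partition.

infix 3 _⊩_
_⊩_ : ∀ {ℓ} {V : Set ℓ} → Triple V → Clause V → Set ℓ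
α ⊩ C = positive C ≬ 𝟏
      ⊎ negative C ≬ 𝟎
      ⊎ (positive C ∪ negative C ⊆ bot × Satisfiable bot)
  where open Triple α

module _ {ℓ} (G : Graph ℓ) where
  open Graph G

  A A⁻ : Vertex → Pred Vertex ℓ
  A  x y = Arc x y
  A⁻ x y = x ∈ A y

  A⟨_⟩ A⁻⟨_⟩ A⁻[_] : Pred Vertex ℓ → Pred Vertex ℓ
  A⟨ X ⟩  y = ∃[ x ] x ∈ X × y ∈ A x
  A⁻⟨ X ⟩ y = ∃[ x ] x ∈ X × y ∈ A⁻ x
  A⁻[ X ]   = X ∪ A⁻⟨ X ⟩

  OutFinite : Set ℓ
  OutFinite = ∀ x → ∃[ ys ] (List._∈ ys) ≐ A x

  -- The clauses of the first kind are {x} ∪ A(x), specified by their members;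
  -- such a clause exists as a finite set precisely when A(x) is finite.

  data 𝒞 : Pred (Clause Vertex) ℓ where
    out : ∀ x {C} →
          ⟦ C ⟧ ≐ ｛ pos x ｝ ∪ (λ l → ∃[ y ] y ∈ A x × l ≡ pos y) →
          𝒞 C
    arc : ∀ x y {C} → y ∈ A x →
          ⟦ C ⟧ ≐ ｛ neg x ｝ ∪ ｛ neg y ｝ →
          𝒞 C

  G⊥ Gok : Pred Vertex ℓ
  G⊥ x = (𝒞 ⊢ [ pos x ]) × (𝒞 ⊢ [ neg x ])
  Gok  = ∁ G⊥

  SK : Pred (Pred Vertex ℓ) ℓ
  SK S = A⟨ S ⟩ ⊆ A⁻⟨ S ⟩ × A⁻⟨ S ⟩ ⊆ ∁ S

  Mod : Pred (Pred Vertex ℓ) (suc ℓ)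
  Mod S = S ∈ SK
        × A⁻⟨ A⁻[ S ] ⟩ ⊆ A⁻[ S ]
        × ¬ (∃[ R ] R ∈ SK × A⁻⟨ A⁻[ R ] ⟩ ⊆ A⁻[ R ] × A⁻[ S ] ⊂ A⁻[ R ])

  α : Pred Vertex ℓ → Triple Vertex
  α S = ⟨ S , A⁻⟨ S ⟩ , ∁ A⁻[ S ] ⟩

  α-is3Partition : ExcludedMiddle ℓ → ∀ {S} → S ∈ SK → Is3Partition (α S)
  α-is3Partition em {S} (_ , A⁻S⊆∁S) = record
    { 𝟏-𝟎   = λ (s , z) → A⁻S⊆∁S z s
    ; 𝟏-bot = λ (s , b) → b (inj₁ s)
    ; 𝟎-bot = λ (z , b) → b (inj₂ z)
    ; cover = λ x → case em {P = x ∈ A⁻[ S ]} of λ where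
        (yes (inj₁ s)) → inj₁ s
        (yes (inj₂ z)) → inj₂ (inj₁ z)
        (no b)         → inj₂ (inj₂ b)
    }

-- G ⊨ C is Γ ⊨ C for Γ = 𝒞 G: the consequence relation refers to Γ only
-- through the graph.

infix 3 _⊨_
_⊨_ : ∀ {ℓ} (G : Graph ℓ) → Clause (Graph.Vertex G) → Set (suc ℓ)
G ⊨ C = ∀ S → S ∈ Mod G → α G S ⊩ C

{-# OPTIONS --safe #-}

-- RES is sound for every semikernel R with A⁻[R] closed under predecessors, so
-- no such R decides a vertex of G⊥.  Conversely, call a set F of literals
-- consistent if it includes no nonempty derivable clause over Gok.  In a maximal
-- consistent F, for x ∈ Gok exactly one of x, x̄ lies in F: otherwise the two
-- clauses blocking x and x̄ resolve either to a clause included in F or to the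
-- empty clause, and in the latter case x ∈ G⊥.  Reading F as the set of false
-- literals gives a semikernel S with A⁻[S] = Gok, which is hence in Mod.  So all
-- members of Mod have G⊥ as their undetermined part, and when (2) fails for A,
-- extending A to a maximal consistent F gives an S that falsifies every literal
-- of A over Gok.

module Submission where

open import Level using (Level; suc; Lift; lift; lower)
open import Axiom.ExcludedMiddle using (ExcludedMiddle)
open import Data.Empty using (⊥; ⊥-elim)
open import Data.List.Base using (List; []; _∷_; _++_; [_]; filter; map)
open import Data.List.Membership.Propositional using () renaming (_∈_ to _∈ˡ_)
open import Data.List.Membership.Propositional.Properties
  using (∈-++⁺ˡ; ∈-++⁺ʳ; ∈-++⁻; ∈-filter⁺; ∈-filter⁻; ∈-map⁺; ∈-map⁻)
open import Data.List.Properties using (++-identityʳ; ++-conicalˡ; ++-conicalʳ)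
open import Data.List.Relation.Binary.Permutation.Propositional using (_↭_; ↭-sym)
open import Data.List.Relation.Binary.Permutation.Propositional.Properties
  using (∈-resp-↭; shift; ++-comm)
open import Data.List.Relation.Unary.Any using (here; there)
open import Data.Product using (∃-syntax; _×_; _,_; proj₁; proj₂)
open import Data.Sum using (_⊎_; inj₁; inj₂; [_,_]′)
open import Function.Base using (id; _∘_; case_of_)
open import Function.Bundles using (_⇔_; mk⇔)
open import Relation.Binary.Bundles using (Poset)
open import Relation.Binary.PropositionalEquality
  using (_≡_; _≢_; refl; sym; subst)
open import Relation.Nullary using (¬_; yes; no)
open import Relation.Nullary.Decidable
  using (True; toWitness; fromWitness; decidable-stable)
open import Relation.Unary
  using (Pred; Decidable; _∈_; _∉_; _⊆_; _≐_; _∪_; _∩_; ∁; ｛_｝; Satisfiable)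
open import Defs

private
  variable
    ℓ : Level
    V : Set ℓ

-- Derived rules of resolution.

complement : Literal V → Literal V
complement (pos x) = neg x
complement (neg x) = pos x

module _ {ℓ} {V : Set ℓ} {Γ : Pred (Clause V) ℓ} where

  ⊢-resp-↭ : ∀ {C D} → C ↭ D → Γ ⊢ C → Γ ⊢ D
  ⊢-resp-↭ π = set (∈-resp-↭ π , ∈-resp-↭ (↭-sym π))

  resolve : ∀ l {A B} → Γ ⊢ l ∷ A → Γ ⊢ complement l ∷ B → Γ ⊢ A ++ B
  resolve (pos a)         p q = res a p q
  resolve (neg a) {A} {B} p q = ⊢-resp-↭ (++-comm B A) (res a q p)

  module _ {p} {X : Pred (Literal V) p} (X? : Decidable X) where

    private
      -- Resolution acts on the head of a list, so literals that are kept move into `E` to expose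
      -- the next one.
      filter-++ : ∀ D {E} →
        (∀ {l} → l ∈ˡ D → l ∉ X → Γ ⊢ [ complement l ]) →
        Γ ⊢ D ++ E → Γ ⊢ filter X? D ++ E
      filter-++ []      unit d = d
      filter-++ (l ∷ D) {E} unit d with X? l
      ... | yes _  = ⊢-resp-↭ (shift l _ E)
                       (filter-++ D (unit ∘ there) (⊢-resp-↭ (↭-sym (shift l D E)) d))
      ... | no l∉X = filter-++ D (unit ∘ there)
                       (subst (Γ ⊢_) (++-identityʳ _) (resolve l d (unit (here refl) l∉X)))

    -- Each literal outside `X` is resolved against the unit clause of its complement, which
    -- contributes no new literal.
    ⊢-filter : ∀ {C} → (∀ {l} → l ∈ˡ C → l ∉ X → Γ ⊢ [ complement l ]) →
               Γ ⊢ C → Γ ⊢ filter X? C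
    ⊢-filter {C} unit d =
      subst (Γ ⊢_) (++-identityʳ _)
        (filter-++ C unit (subst (Γ ⊢_) (sym (++-identityʳ C)) d))

-- Soundness of resolution for three-valued satisfaction.

module _ {ℓ} {V : Set ℓ} (α : Triple V) where
  open Triple α

  holds : Pred (Literal V) ℓ
  holds (pos x) = x ∈ 𝟏
  holds (neg x) = x ∈ 𝟎

  -- A form of `⊩` by literals, which spares separate cases for positive and negative occurrences.
  Holds : Pred (Clause V) ℓ
  Holds C = (∃[ l ] l ∈ˡ C × l ∈ holds) ⊎ (⟦ C ⟧ ⊆ bot ̈ × Satisfiable bot)

  Holds⇒⊩ : ∀ {C} → Holds C → α ⊩ C
  Holds⇒⊩ (inj₁ (pos x , x∈C , h)) = inj₁ (x , x∈C , h)
  Holds⇒⊩ (inj₁ (neg x , x∈C , h)) = inj₂ (inj₁ (x , x∈C , h))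
  Holds⇒⊩ (inj₂ (C⊆bot , b))       = inj₂ (inj₂ ([ C⊆bot , C⊆bot ]′ , b))

  ⊩⇒Holds : ∀ {C} → α ⊩ C → Holds C
  ⊩⇒Holds (inj₁ (x , x∈C , h))        = inj₁ (pos x , x∈C , h)
  ⊩⇒Holds (inj₂ (inj₁ (x , x∈C , h))) = inj₁ (neg x , x∈C , h)
  ⊩⇒Holds (inj₂ (inj₂ (C⊆bot , b)))   = inj₂
    ((λ { {pos x} x∈C → C⊆bot (inj₁ x∈C) ; {neg x} x∈C → C⊆bot (inj₂ x∈C) }) , b)

  module _ (α-3 : Is3Partition α) where
    open Is3Partition α-3

    Holds-tail : ∀ {l C} → l ∉ holds → l ∉ bot ̈ → Holds (l ∷ C) →
                 ∃[ k ] k ∈ˡ C × k ∈ holds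
    Holds-tail ¬h ¬b (inj₁ (_ , here refl , h)) = ⊥-elim (¬h h)
    Holds-tail ¬h ¬b (inj₁ (k , there k∈C , h)) = k , k∈C , h
    Holds-tail ¬h ¬b (inj₂ (C⊆bot , _))         = ⊥-elim (¬b (C⊆bot (here refl)))

    Holds-tail-bot : ∀ {l C} → l ∉ holds → Holds (l ∷ C) → Holds C
    Holds-tail-bot ¬h (inj₁ (_ , here refl , h)) = ⊥-elim (¬h h)
    Holds-tail-bot ¬h (inj₁ (k , there k∈C , h)) = inj₁ (k , k∈C , h)
    Holds-tail-bot ¬h (inj₂ (C⊆bot , b))         = inj₂ (C⊆bot ∘ there , b)

    Holds-++ : ∀ {A B} → Holds A → Holds B → Holds (A ++ B)
    Holds-++     (inj₁ (k , k∈A , h)) _                    = inj₁ (k , ∈-++⁺ˡ k∈A , h)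
    Holds-++ {A} (inj₂ _)             (inj₁ (k , k∈B , h)) = inj₁ (k , ∈-++⁺ʳ A k∈B , h)
    Holds-++ {A} (inj₂ (A⊆bot , b))   (inj₂ (B⊆bot , _))   =
      inj₂ ([ A⊆bot , B⊆bot ]′ ∘ ∈-++⁻ A , b)

    -- If the pivot is determined, it is false in one premise, whose true literal survives. If it is
    -- undetermined, both premises still hold without it. The resolvent may then be empty; it holds
    -- because `bot` is inhabited.
    ⊢-sound : ∀ {Γ} → Γ ⊆ Holds → ∀ {C} → Γ ⊢ C → Holds C
    ⊢-sound Γ⊆ (hyp C∈Γ) = Γ⊆ C∈Γ
    ⊢-sound Γ⊆ (ax a) with cover a
    ... | inj₁ a∈𝟏          = inj₁ (pos a , here refl , a∈𝟏)
    ... | inj₂ (inj₁ a∈𝟎)   = inj₁ (neg a , there (here refl) , a∈𝟎)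
    ... | inj₂ (inj₂ a∈bot) =
      inj₂ ((λ { (here refl) → a∈bot ; (there (here refl)) → a∈bot }) , a , a∈bot)
    ⊢-sound Γ⊆ (res {A} {B} a p q) with ⊢-sound Γ⊆ p | ⊢-sound Γ⊆ q | cover a
    ... | _ | q′ | inj₁ a∈𝟏 =
      let k , k∈B , h = Holds-tail (λ a∈𝟎 → 𝟏-𝟎 (a∈𝟏 , a∈𝟎)) (λ b → 𝟏-bot (a∈𝟏 , b)) q′
      in inj₁ (k , ∈-++⁺ʳ A k∈B , h)
    ... | p′ | _ | inj₂ (inj₁ a∈𝟎) =
      let k , k∈A , h = Holds-tail (λ a∈𝟏 → 𝟏-𝟎 (a∈𝟏 , a∈𝟎)) (λ b → 𝟎-bot (a∈𝟎 , b)) p′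
      in inj₁ (k , ∈-++⁺ˡ k∈A , h)
    ... | p′ | q′ | inj₂ (inj₂ a∈bot) =
      Holds-++ (Holds-tail-bot (λ a∈𝟏 → 𝟏-bot (a∈𝟏 , a∈bot)) p′)
               (Holds-tail-bot (λ a∈𝟎 → 𝟎-bot (a∈𝟎 , a∈bot)) q′)
    ⊢-sound Γ⊆ (set (C⊆D , D⊆C) p) with ⊢-sound Γ⊆ p
    ... | inj₁ (k , k∈C , h) = inj₁ (k , C⊆D k∈C , h)
    ... | inj₂ (C⊆bot , b)   = inj₂ (C⊆bot ∘ D⊆C , b)

-- Consequences of excluded middle and Zorn's lemma.

module _ (em : ∀ {a} → ExcludedMiddle a) where

  -- All copies of `l` are deleted before one is put in front, so the remainder is free of `l`.
  ⊢-isolate : ∀ {V : Set ℓ} {Γ : Pred (Clause V) ℓ} {l C} → l ∈ˡ C → Γ ⊢ C →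
              ∃[ D ] (⟦ D ⟧ ⊆ ⟦ C ⟧ ∩ ∁ ｛ l ｝) × Γ ⊢ l ∷ D
  ⊢-isolate {l = l} {C} l∈C d = filter ≢l? C , ∈-filter⁻ ≢l? {xs = C} , set (to , from) d
    where
    ≢l? : Decidable (∁ ｛ l ｝)
    ≢l? _ = em

    to : ⟦ C ⟧ ⊆ ⟦ l ∷ filter ≢l? C ⟧
    to {k} k∈C with em {P = l ≡ k}
    ... | yes refl = here refl
    ... | no l≢k   = there (∈-filter⁺ ≢l? k∈C l≢k)

    from : ⟦ l ∷ filter ≢l? C ⟧ ⊆ ⟦ C ⟧
    from (here refl) = l∈C
    from (there k∈)  = proj₁ (∈-filter⁻ ≢l? k∈)

  module _ (zorn : ∀ {c ℓ₁ ℓ₂} → ZornsLemma c ℓ₁ ℓ₂) where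

    -- The Teichmüller–Tukey lemma.
    maximal-avoiding : {X : Set ℓ} (𝓑 : Pred (List X) ℓ) {F₀ : Pred X ℓ} →
      (∀ {B} → B ∈ 𝓑 → ¬ (_∈ˡ B) ⊆ F₀) →
      ∃[ F ] F₀ ⊆ F
           × (∀ {B} → B ∈ 𝓑 → ¬ (_∈ˡ B) ⊆ F)
           × (∀ x → x ∉ F → ∃[ B ] B ∈ 𝓑 × (_∈ˡ B) ⊆ F ∪ ｛ x ｝)
    maximal-avoiding {ℓ} {X} 𝓑 {F₀} F₀-avoids = F , F₀⊆F , F-avoids , blocked
      where
      Avoids : Pred (Pred X ℓ) ℓ
      Avoids F = ∀ {B} → B ∈ 𝓑 → ¬ (_∈ˡ B) ⊆ F

      P : Poset (suc ℓ) ℓ ℓ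
      P = record
        { Carrier        = ∃[ F ] F₀ ⊆ F × Avoids F
        ; _≈_            = λ F G → proj₁ F ≐ proj₁ G
        ; _≤_            = λ F G → proj₁ F ⊆ proj₁ G
        ; isPartialOrder = record
          { isPreorder = record
            { isEquivalence = record
              { refl  = id , id
              ; sym   = λ (p , q) → q , p
              ; trans = λ (p , q) (p′ , q′) → p′ ∘ p , q ∘ q′
              }
            ; reflexive = proj₁
            ; trans     = λ p q → q ∘ p
            }
          ; antisym = _,_
          }
        }
      open Poset P using (Carrier; _≤_)

      bounded : (K : Pred Carrier (suc ℓ)) →
                (∀ {F G} → F ∈ K → G ∈ K → F ≤ G ⊎ G ≤ F) →
                ∃[ U ] (∀ {F} → F ∈ K → F ≤ U)
      bounded K chain = (U , (λ x∈F₀ → intro (inj₁ x∈F₀)) , U-avoids)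
                      , λ F∈K x∈F → intro (inj₂ (_ , F∈K , x∈F))
        where
        -- Joining `F₀` makes the bound include `F₀` even when the chain is empty.
        Member : Pred X (suc ℓ)
        Member x = x ∈ F₀ ⊎ (∃[ F ] F ∈ K × x ∈ proj₁ F)

        -- Excluded middle brings the union down from level suc ℓ to ℓ.
        U : Pred X ℓ
        U x = Lift ℓ (True (em {P = Member x}))

        intro : Member ⊆ U
        intro m = lift (fromWitness m)

        -- Induction on `B`: of the two chain members covering head and tail, the larger covers
        -- both.
        finite : ∀ B → (_∈ˡ B) ⊆ U →
                 (_∈ˡ B) ⊆ F₀ ⊎ (∃[ F ] F ∈ K × (_∈ˡ B) ⊆ proj₁ F)
        finite []      _   = inj₁ λ ()
        finite (x ∷ B) B⊆U
          with toWitness (lower (B⊆U (here refl))) | finite B (B⊆U ∘ there)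
        ... | inj₁ x∈F₀ | inj₁ B⊆F₀ =
          inj₁ λ { (here refl) → x∈F₀ ; (there y) → B⊆F₀ y }
        ... | inj₁ x∈F₀ | inj₂ (F , F∈K , B⊆F) =
          inj₂ (F , F∈K , λ { (here refl) → proj₁ (proj₂ F) x∈F₀ ; (there y) → B⊆F y })
        ... | inj₂ (F , F∈K , x∈F) | inj₁ B⊆F₀ =
          inj₂ (F , F∈K , λ { (here refl) → x∈F ; (there y) → proj₁ (proj₂ F) (B⊆F₀ y) })
        ... | inj₂ (F , F∈K , x∈F) | inj₂ (G , G∈K , B⊆G) with chain F∈K G∈K
        ...   | inj₁ F≤G =
          inj₂ (G , G∈K , λ { (here refl) → F≤G x∈F ; (there y) → B⊆G y })
        ...   | inj₂ G≤F =
          inj₂ (F , F∈K , λ { (here refl) → x∈F ; (there y) → G≤F (B⊆G y) })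

        U-avoids : Avoids U
        U-avoids {B} B∈𝓑 B⊆U with finite B B⊆U
        ... | inj₁ B⊆F₀                       = F₀-avoids B∈𝓑 B⊆F₀
        ... | inj₂ ((_ , _ , avoids) , _ , B⊆F) = avoids B∈𝓑 B⊆F

      maximum : ∃[ M ] (∀ N → M ≤ N → proj₁ N ≐ proj₁ M)
      maximum = zorn P bounded

      F : Pred X ℓ
      F = proj₁ (proj₁ maximum)

      F₀⊆F : F₀ ⊆ F
      F₀⊆F = proj₁ (proj₂ (proj₁ maximum))

      F-avoids : Avoids F
      F-avoids = proj₂ (proj₂ (proj₁ maximum))

      blocked : ∀ x → x ∉ F → ∃[ B ] B ∈ 𝓑 × (_∈ˡ B) ⊆ F ∪ ｛ x ｝
      blocked x x∉F with em {P = ∃[ B ] B ∈ 𝓑 × (_∈ˡ B) ⊆ F ∪ ｛ x ｝}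
      ... | yes ∃B = ∃B
      -- If nothing blocks `x`, then `F` with `x` added still avoids `𝓑`, and maximality puts `x` in
      -- `F`.
      ... | no ¬∃B = ⊥-elim (x∉F (proj₁ (proj₂ maximum larger inj₁) (inj₂ refl)))
        where
        larger : Carrier
        larger = F ∪ ｛ x ｝ , inj₁ ∘ F₀⊆F , λ B∈𝓑 B⊆ → ¬∃B (_ , B∈𝓑 , B⊆)

  -- Closed semikernels and derivability.

  module _ {ℓ} (G : Graph ℓ) where
    open Graph G

    module _ {R : Pred Vertex ℓ} (R∈SK : R ∈ SK G)
             (closed : A⁻⟨_⟩ G (A⁻[_] G R) ⊆ A⁻[_] G R) where

      -- If `x` is undetermined, closure under predecessors makes all its successors undetermined,
      -- so its clauses are entirely undetermined.
      𝒞-holds : 𝒞 G ⊆ Holds (α G R)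
      𝒞-holds (out x (_ , ⊆C)) with em {P = x ∈ A⁻[_] G R}
      ... | yes (inj₁ x∈R)             = inj₁ (pos x , ⊆C (inj₁ refl) , x∈R)
      ... | yes (inj₂ (y , y∈R , x→y)) = inj₁ (pos y , ⊆C (inj₂ (y , x→y , refl)) , y∈R)
      𝒞-holds (out x (C⊆ , _)) | no x∈bot = inj₂ (undetermined ∘ C⊆ , x , x∈bot)
        where
        undetermined : ｛ pos x ｝ ∪ (λ l → ∃[ y ] y ∈ A G x × l ≡ pos y) ⊆ (∁ (A⁻[_] G R)) ̈
        undetermined (inj₁ refl)             = x∈bot
        undetermined (inj₂ (y , x→y , refl)) = λ y∈ → x∈bot (closed (y , y∈ , x→y))
      𝒞-holds (arc x y x→y (_ , ⊆C)) with em {P = x ∈ A⁻[_] G R}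
      ... | yes (inj₁ x∈R) = inj₁ (neg y , ⊆C (inj₂ refl) , proj₁ R∈SK (x , x∈R , x→y))
      ... | yes (inj₂ x∈𝟎) = inj₁ (neg x , ⊆C (inj₁ refl) , x∈𝟎)
      𝒞-holds (arc x y x→y (C⊆ , _)) | no x∈bot = inj₂ (undetermined ∘ C⊆ , x , x∈bot)
        where
        undetermined : ｛ neg x ｝ ∪ ｛ neg y ｝ ⊆ (∁ (A⁻[_] G R)) ̈
        undetermined (inj₁ refl) = x∈bot
        undetermined (inj₂ refl) = λ y∈ → x∈bot (closed (y , y∈ , x→y))

      𝒞-sound : ∀ {C} → 𝒞 G ⊢ C → Holds (α G R) C
      𝒞-sound = ⊢-sound (α G R) (α-is3Partition G em R∈SK) 𝒞-holds

      G⊥-undetermined : G⊥ G ⊆ ∁ (A⁻[_] G R)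
      G⊥-undetermined (⊢x , ⊢x̄) with 𝒞-sound ⊢x | 𝒞-sound ⊢x̄
      ... | inj₂ (x⊆bot , _)          | _                           = x⊆bot (here refl)
      ... | inj₁ _                    | inj₂ (x̄⊆bot , _)            = x̄⊆bot (here refl)
      ... | inj₁ (_ , here refl , x∈R) | inj₁ (_ , here refl , x∈𝟎) =
        ⊥-elim (proj₂ R∈SK x∈𝟎 x∈R)

      A⁻[R]⊆Gok : A⁻[_] G R ⊆ Gok G
      A⁻[R]⊆Gok x∈ x∈G⊥ = G⊥-undetermined x∈G⊥ x∈

    ok? : Decidable (Gok G ̈)
    ok? _ = em

    -- Supplies the unit clauses with which `⊢-filter` deletes all literals over `G⊥`.
    complement-unit : ∀ {l} → l ∉ Gok G ̈ → 𝒞 G ⊢ [ complement l ]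
    complement-unit {pos x} x∉ok = proj₂ (decidable-stable em x∉ok)
    complement-unit {neg x} x∉ok = proj₁ (decidable-stable em x∉ok)

    -- Out-finite graphs: successors of vertices in `G⊥`.

    module _ (fin : OutFinite G) where

      out-clause : ∀ x → ∃[ C ] ⟦ C ⟧ ≐ ｛ pos x ｝ ∪ (λ l → ∃[ y ] y ∈ A G x × l ≡ pos y)
      out-clause x = pos x ∷ map pos ys , to , from
        where
        ys : List Vertex
        ys = proj₁ (fin x)
        to : ⟦ pos x ∷ map pos ys ⟧ ⊆ _
        to (here refl) = inj₁ refl
        to (there l∈)  = let y , y∈ys , l≡ = ∈-map⁻ pos l∈
                         in inj₂ (y , proj₁ (proj₂ (fin x)) y∈ys , l≡)
        from : _ ⊆ ⟦ pos x ∷ map pos ys ⟧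
        from (inj₁ refl)             = here refl
        from (inj₂ (y , x→y , refl)) = there (∈-map⁺ pos (proj₂ (proj₂ (fin x)) x→y))

      ⊢-arc : ∀ {x y} → y ∈ A G x → 𝒞 G ⊢ neg x ∷ neg y ∷ []
      ⊢-arc x→y = hyp (arc _ _ x→y
        ( (λ { (here refl) → inj₁ refl ; (there (here refl)) → inj₂ refl })
        , (λ { (inj₁ refl) → here refl ; (inj₂ refl) → there (here refl) })))

      -- The arc clauses and `⊢x` refute every successor of `x`. Together with `⊢x̄` these units
      -- strip the out-clause of `x` down to `pos y`. Consequently `Gok` is closed under
      -- predecessors.
      G⊥-successor : ∀ {x y} → y ∈ A G x → x ∈ G⊥ G → y ∈ G⊥ G
      G⊥-successor {x} {y} x→y (⊢x , ⊢x̄) = ⊢y , ⊢-successor x→y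
        where
        ⊢-successor : ∀ {z} → z ∈ A G x → 𝒞 G ⊢ [ neg z ]
        ⊢-successor x→z = res x ⊢x (⊢-arc x→z)

        C : Clause Vertex
        C = proj₁ (out-clause x)

        C≐ : ⟦ C ⟧ ≐ _
        C≐ = proj₂ (out-clause x)

        ≡y? : Decidable ｛ pos y ｝
        ≡y? _ = em

        unit : ∀ {l} → l ∈ˡ C → l ∉ ｛ pos y ｝ → 𝒞 G ⊢ [ complement l ]
        unit l∈C _ with proj₁ C≐ l∈C
        ... | inj₁ refl             = ⊢x̄
        ... | inj₂ (z , x→z , refl) = ⊢-successor x→z

        ⊢y : 𝒞 G ⊢ [ pos y ]
        ⊢y = set ( (λ l∈ → here (sym (proj₂ (∈-filter⁻ ≡y? {xs = C} l∈))))
                 , λ { (here refl) → ∈-filter⁺ ≡y? (proj₂ C≐ (inj₂ (y , x→y , refl))) refl })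
                 (⊢-filter ≡y? unit (hyp (out x C≐)))

      -- The empty clause is derivable once `G⊥` is inhabited and is included in every set, so it
      -- must not count as forbidden.
      OkClause : Pred (Clause Vertex) ℓ
      OkClause B = B ≢ [] × ⟦ B ⟧ ⊆ Gok G ̈ × (𝒞 G ⊢ B)

      -- The semikernel of a maximal consistent set of literals.

      module _ {F : Pred (Literal Vertex) ℓ}
               (avoids  : ∀ {B} → B ∈ OkClause → ¬ ⟦ B ⟧ ⊆ F)
               (blocked : ∀ l → l ∉ F → ∃[ B ] B ∈ OkClause × ⟦ B ⟧ ⊆ F ∪ ｛ l ｝) where

        -- The blocking clause must contain `l`, as otherwise it would already be included in `F`.
        isolate-blocked : ∀ {l} → l ∉ F →
          ∃[ D ] (⟦ D ⟧ ⊆ F ∩ (Gok G ̈)) × 𝒞 G ⊢ l ∷ D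
        isolate-blocked {l} l∉F
          with B , ok@(_ , B⊆ok , ⊢B) , B⊆ ← blocked l l∉F
          with em {P = l ∈ˡ B}
        ... | no l∉B  = ⊥-elim (avoids ok λ k∈B →
                          [ id , (λ { refl → ⊥-elim (l∉B k∈B) }) ]′ (B⊆ k∈B))
        ... | yes l∈B
          with D , D⊆ , ⊢lD ← ⊢-isolate l∈B ⊢B = D , D⊆F∩ok , ⊢lD
          where
          D⊆F∩ok : ⟦ D ⟧ ⊆ F ∩ (Gok G ̈)
          D⊆F∩ok k∈D with D⊆ k∈D
          ... | k∈B , l≢k = [ id , ⊥-elim ∘ l≢k ]′ (B⊆ k∈B) , B⊆ok k∈B

        decided : ∀ {x} → x ∈ Gok G → pos x ∉ F → neg x ∈ F
        decided {x} x∈ok x∉F = decidable-stable em λ x̄∉F →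
          let D , D⊆ , ⊢xD = isolate-blocked x∉F
              E , E⊆ , ⊢x̄E = isolate-blocked x̄∉F
              D++E⊆ : ⟦ D ++ E ⟧ ⊆ F ∩ (Gok G ̈)
              D++E⊆ l∈ = [ D⊆ , E⊆ ]′ (∈-++⁻ D l∈)
              D++E≢[] : D ++ E ≢ []
              D++E≢[] e = x∈ok
                ( subst (λ C → 𝒞 G ⊢ pos x ∷ C) (++-conicalˡ D E e) ⊢xD
                , subst (λ C → 𝒞 G ⊢ neg x ∷ C) (++-conicalʳ D E e) ⊢x̄E )
          in avoids (D++E≢[] , (λ l∈ → proj₂ (D++E⊆ l∈)) , res x ⊢xD ⊢x̄E)
                    (λ l∈ → proj₁ (D++E⊆ l∈))

        -- For `x` in `Gok`, the axiom on `x` is itself an `OkClause`.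
        exclusive : ∀ {x} → x ∈ Gok G → pos x ∈ F → neg x ∉ F
        exclusive {x} x∈ok x∈F x̄∈F = avoids
          ( (λ ())
          , (λ { (here refl) → x∈ok ; (there (here refl)) → x∈ok })
          , ax x )
          λ { (here refl) → x∈F ; (there (here refl)) → x̄∈F }

        -- The part of `C` over `Gok` is derivable, and `k` makes it nonempty, so `F` cannot include
        -- it.
        satisfied : ∀ {C k} → 𝒞 G ⊢ C → k ∈ˡ C → k ∈ Gok G ̈ →
                    ∃[ l ] l ∈ˡ C × l ∈ Gok G ̈ × l ∉ F
        satisfied {C} ⊢C k∈C k∈ok = decidable-stable em λ ¬∃ → avoids
          ( (λ e → case subst (_ ∈ˡ_) e (∈-filter⁺ ok? k∈C k∈ok) of λ ())
          , (λ l∈ → proj₂ (∈-filter⁻ ok? {xs = C} l∈))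
          , ⊢-filter ok? (λ _ → complement-unit) ⊢C )
          λ l∈ → let l∈C , l∈ok = ∈-filter⁻ ok? {xs = C} l∈
                 in decidable-stable em λ l∉F → ¬∃ (_ , l∈C , l∈ok , l∉F)

        S : Pred Vertex ℓ
        S x = x ∈ Gok G × pos x ∉ F

        S-successor : ∀ {x y} → x ∈ S → y ∈ A G x → y ∈ Gok G × neg y ∉ F
        S-successor (x∈ok , x∉F) x→y with satisfied (⊢-arc x→y) (here refl) x∈ok
        -- `neg x` lies in `F` by `decided`, so the literal found outside `F` can only be `neg y`.
        ... | _ , here refl         , _    , x̄∉F = ⊥-elim (x̄∉F (decided x∈ok x∉F))
        ... | _ , there (here refl) , y∈ok , ȳ∉F = y∈ok , ȳ∉F

        -- The out-clause of `x` has a literal over `Gok` outside `F`. As `pos x` is in `F`, that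
        -- literal is a successor of `x` in `S`.
        Gok-false : ∀ {x} → x ∈ Gok G → pos x ∈ F → x ∈ A⁻⟨_⟩ G S
        Gok-false {x} x∈ok x∈F
          with C , C≐ ← out-clause x
          with l , l∈C , l∈ok , l∉F ← satisfied (hyp (out x C≐)) (proj₂ C≐ (inj₁ refl)) x∈ok
          with proj₁ C≐ l∈C
        ... | inj₁ refl             = ⊥-elim (l∉F x∈F)
        ... | inj₂ (y , x→y , refl) = y , (l∈ok , l∉F) , x→y

        Gok⊆A⁻[S] : Gok G ⊆ A⁻[_] G S
        Gok⊆A⁻[S] {x} x∈ok with em {P = pos x ∈ F}
        ... | yes x∈F = inj₂ (Gok-false x∈ok x∈F)
        ... | no x∉F  = inj₁ (x∈ok , x∉F)

        S∈SK : S ∈ SK G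
        S∈SK = (λ (x , x∈S , x→y) →
                  let y∈ok , ȳ∉F = S-successor x∈S x→y
                  in Gok-false y∈ok (decidable-stable em (ȳ∉F ∘ decided y∈ok)))
             -- For `x` and its successor `y` both in `S`, `neg y` would lie outside `F` by
             -- `S-successor` and inside it by `decided`.
             , (λ (y , (y∈ok , y∉F) , x→y) x∈S →
                  proj₂ (S-successor x∈S x→y) (decided y∈ok y∉F))

        A⁻[S]⊆Gok : A⁻[_] G S ⊆ Gok G
        A⁻[S]⊆Gok (inj₁ (x∈ok , _))             = x∈ok
        A⁻[S]⊆Gok (inj₂ (y , (y∈ok , _) , x→y)) = y∈ok ∘ G⊥-successor x→y

        S-closed : A⁻⟨_⟩ G (A⁻[_] G S) ⊆ A⁻[_] G S
        S-closed (y , y∈ , x→y) = Gok⊆A⁻[S] (A⁻[S]⊆Gok y∈ ∘ G⊥-successor x→y)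

        S∈Mod : S ∈ Mod G
        S∈Mod = S∈SK , S-closed , λ (R , R∈SK , R-closed , _ , A⁻[R]⊈A⁻[S]) →
          A⁻[R]⊈A⁻[S] (Gok⊆A⁻[S] ∘ A⁻[R]⊆Gok R∈SK R-closed)

        falsified : ∀ {l} → l ∈ F → l ∉ holds (α G S)
        falsified {pos x} x∈F (_ , x∉F) = x∉F x∈F
        falsified {neg x} x̄∈F x∈𝟎       = exclusive x∈ok x∈F x̄∈F
          where
          x∈ok : x ∈ Gok G
          x∈ok = A⁻[S]⊆Gok (inj₂ x∈𝟎)
          x∈F : pos x ∈ F
          x∈F = decidable-stable em λ x∉F → proj₂ S∈SK x∈𝟎 (x∈ok , x∉F)

      -- Countermodels and the determined part of members of `Mod`.

      module _ (zorn : ∀ {c ℓ₁ ℓ₂} → ZornsLemma c ℓ₁ ℓ₂) where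

        countermodel : ∀ {F₀ : Pred (Literal Vertex) ℓ} →
          (∀ {B} → B ∈ OkClause → ¬ ⟦ B ⟧ ⊆ F₀) →
          ∃[ S ] S ∈ Mod G × Gok G ⊆ A⁻[_] G S × (∀ {l} → l ∈ F₀ → l ∉ holds (α G S))
        countermodel F₀-avoids =
          let F , F₀⊆F , avoids , blocked = maximal-avoiding zorn OkClause F₀-avoids
          in S avoids blocked , S∈Mod avoids blocked , Gok⊆A⁻[S] avoids blocked
           , falsified avoids blocked ∘ F₀⊆F

        -- The empty set extends to a closed semikernel `T` with `Gok` inside `A⁻[T]`. If `R` missed
        -- a vertex of `Gok`, `A⁻[R]` would be strictly smaller, against maximality.
        Mod-decides : ∀ {R} → R ∈ Mod G → Gok G ⊆ A⁻[_] G R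
        Mod-decides {R} (R∈SK , R-closed , R-max) =
          let T , (T∈SK , T-closed , _) , Gok⊆ , _ = countermodel ∅-avoids
          in decidable-stable em λ Gok⊈ → R-max
               ( T , T∈SK , T-closed
               , Gok⊆ ∘ A⁻[R]⊆Gok R∈SK R-closed
               , λ T⊆R → Gok⊈ (T⊆R ∘ Gok⊆) )
          where
          ∅-avoids : ∀ {B} → B ∈ OkClause → ¬ ⟦ B ⟧ ⊆ (λ _ → Lift ℓ ⊥)
          ∅-avoids {[]}    (B≢[] , _) _ = B≢[] refl
          ∅-avoids {_ ∷ _} _ B⊆∅        = lower (B⊆∅ (here refl))

-- The two directions of the equivalence.

corollary4p11 : (∀ {a} → ExcludedMiddle a) →
    (∀ {c ℓ₁ ℓ₂} → ZornsLemma c ℓ₁ ℓ₂) →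
    ∀ {ℓ} (G : Graph ℓ) → OutFinite G →
    (A : Clause (Graph.Vertex G)) →
    (G ⊨ A)
    ⇔
    ((⟦ A ⟧ ⊆ (G⊥ G) ̈ × Satisfiable (G⊥ G))
    ⊎ (∃[ B ] B ≢ [] × ⟦ B ⟧ ⊆ ⟦ A ⟧ ∩ ((Gok G) ̈) × (𝒞 G ⊢ B)))
corollary4p11 em zorn {ℓ} G fin A = mk⇔ to [ from₁ , from₂ ]′
  where
  to : G ⊨ A → _
  to G⊨A with em {P = ∃[ B ] B ≢ [] × ⟦ B ⟧ ⊆ ⟦ A ⟧ ∩ ((Gok G) ̈) × (𝒞 G ⊢ B)}
  ... | yes B = inj₂ B
  ... | no ¬B
    -- Any `OkClause` included in `A` would witness (2), so `A` itself can be extended.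
    with S , S∈Mod , Gok⊆ , false ← countermodel em G fin zorn {F₀ = ⟦ A ⟧}
           (λ (B≢[] , B⊆ok , ⊢B) B⊆A → ¬B (_ , B≢[] , (λ l∈B → B⊆A l∈B , B⊆ok l∈B) , ⊢B))
    with ⊩⇒Holds (α G S) (G⊨A S S∈Mod)
  ... | inj₁ (l , l∈A , h)         = ⊥-elim (false l∈A h)
  ... | inj₂ (A⊆bot , x , x∈bot) = inj₁
    ( (λ { {pos _} l∈A → undetermined (A⊆bot l∈A) ; {neg _} l∈A → undetermined (A⊆bot l∈A) })
    , x , undetermined x∈bot )
    where
    undetermined : ∁ (A⁻[_] G S) ⊆ G⊥ G
    undetermined x∉ = decidable-stable em (x∉ ∘ Gok⊆)

  from₁ : ⟦ A ⟧ ⊆ (G⊥ G) ̈ × Satisfiable (G⊥ G) → G ⊨ A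
  from₁ (A⊆G⊥ , x , x∈G⊥) S (S∈SK , S-closed , _) = Holds⇒⊩ (α G S) (inj₂
    ( (λ { {pos _} l∈A → undetermined (A⊆G⊥ l∈A) ; {neg _} l∈A → undetermined (A⊆G⊥ l∈A) })
    , x , undetermined x∈G⊥ ))
    where
    undetermined : G⊥ G ⊆ ∁ (A⁻[_] G S)
    undetermined = G⊥-undetermined em G S∈SK S-closed

  from₂ : (∃[ B ] B ≢ [] × ⟦ B ⟧ ⊆ ⟦ A ⟧ ∩ ((Gok G) ̈) × (𝒞 G ⊢ B)) → G ⊨ A
  from₂ (B , B≢[] , B⊆ , ⊢B) S S∈Mod@(S∈SK , S-closed , _)
    with 𝒞-sound em G S∈SK S-closed ⊢B
  ... | inj₁ (l , l∈B , h) = Holds⇒⊩ (α G S) (inj₁ (l , proj₁ (B⊆ l∈B) , h))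
  -- An entirely undetermined nonempty `B` would have a vertex of `Gok` that `S` leaves
  -- undetermined, contrary to `Mod-decides`.
  ... | inj₂ (B⊆bot , _) with B
  ...   | []        = ⊥-elim (B≢[] refl)
  ...   | pos x ∷ _ =
    ⊥-elim (B⊆bot (here refl) (Mod-decides em G fin zorn S∈Mod (proj₂ (B⊆ (here refl)))))
  ...   | neg x ∷ _ =
    ⊥-elim (B⊆bot (here refl) (Mod-decides em G fin zorn S∈Mod (proj₂ (B⊆ (here refl)))))
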